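{- Every pair of deterministic algorithms for the same metrical task system, starting at the same state, satisfies the switching assumptions.
   Context: Metrical task system: a metric space of states with distance $d$ and an initial state; tasks arrive one by one, task $t$ being a cost function $\ell_t$ from states to $[0,\infty)$. On task $t$ an algorithm in state $u_{t-1}$ moves to a state $u_t$ (after seeing $\ell_t$) and incurs cost $d(u_{t-1},u_t)+\ell_t(u_t)$. Switching assumptions. Fix an online problem and two deterministic online algorithms $X,Y$ for it ("references"), with per-request costs $x_t,y_t\ge0$ and cumulative costs $X_t=\sum_{i\le t}x_i$, $Y_t=\sum_{i\le t}y_i$. The pair $(X,Y)$ satisfies the switching assumptions if there is one uniform online implementation, common to all inputs and all mode schedules, that starts with the algorithm and both references in the same state, with tracking potential $\Psi_0=0$, maintains a mode in $\{X,Y\}$ (the reference currently tracked) and a nonnegative potential $\Psi$, and supports the following operations pathwise: (S) while tracking one reference on a request, the actual cost incurred plus the change in $\Psi$ is at most that reference's cost on the request; (T) changing the tracked reference after prefix $t$, without changing the online state, increases $\Psi$ by at most $D_t$, where $D_t\le X_t+Y_t$. The two deterministic reference trajectories are simulated in parallel, so their current actions and costs are known after the request is revealed and before the combined algorithm acts. The implementation must remain valid after every finite sequence of pre-service and post-service switches, and the switching kernels are measurable. -}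

module Defs where

open import Algebra.Bundles using (CommutativeMonoid)
open import Level using (0ℓ) renaming (suc to lsuc; _⊔_ to _⊔ˡ_)
open import Data.List.Base using (List; []; _∷_)
open import Data.Maybe.Base using (Maybe; just; nothing)
open import Data.Nat.Base as ℕ using (ℕ)
import Data.Nat.Properties as ℕ
open import Data.Product.Base using (Σ-syntax; ∃-syntax; _×_; _,_; proj₁; proj₂)
open import Data.Rational.Base as ℚ using (ℚ; 0ℚ; ½)
import Data.Rational.Properties as ℚ
open import Data.Sum.Base using ([_,_]′)
open import Function.Metric.Structures using (IsGeneralMetric)
open import Relation.Binary.PropositionalEquality using (_≡_; sym; trans; cong; subst; subst₂)
open import Relation.Unary using (Pred; _∈_; _⊢_; ∁; ⋃; ∅; _≐_; _⟨×⟩_)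

-- Real numbers: Cauchy sequences of rationals, with equality up to a
-- null sequence.

Eventually : (ℕ → Set) → Set
Eventually P = ∃[ N ] (∀ n → N ℕ.≤ n → P n)

IsCauchy : (ℕ → ℚ) → Set
IsCauchy s = ∀ ε → 0ℚ ℚ.< ε →
  ∃[ N ] (∀ m n → N ℕ.≤ m → N ℕ.≤ n → ℚ.∣ s m ℚ.- s n ∣ ℚ.≤ ε)

record ℝ : Set where
  constructor mkℝ
  field
    seq    : ℕ → ℚ
    cauchy : IsCauchy seq

open ℝ public

infix 4 _≃_ _≤_ _<_

_≃_ : ℝ → ℝ → Set
x ≃ y = ∀ ε → 0ℚ ℚ.< ε → Eventually λ n → ℚ.∣ seq x n ℚ.- seq y n ∣ ℚ.≤ ε

_≤_ : ℝ → ℝ → Set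
x ≤ y = ∀ ε → 0ℚ ℚ.< ε → Eventually λ n → seq x n ℚ.≤ seq y n ℚ.+ ε

_<_ : ℝ → ℝ → Set
x < y = ∃[ ε ] (0ℚ ℚ.< ε × Eventually λ n → seq x n ℚ.+ ε ℚ.≤ seq y n)

0ℝ : ℝ
0ℝ = mkℝ (λ _ → 0ℚ) λ ε 0<ε → 0 , λ _ _ _ _ → ℚ.<⇒≤ 0<ε

private
  module ℚ₊ where
    open import Algebra.Properties.AbelianGroup ℚ.+-0-abelianGroup public
    open import Algebra.Properties.CommutativeSemigroup
      (CommutativeMonoid.commutativeSemigroup ℚ.+-0-commutativeMonoid) public

  half-pos : ∀ {ε} → 0ℚ ℚ.< ε → 0ℚ ℚ.< ½ ℚ.* ε
  half-pos {ε} 0<ε = subst (ℚ._< ½ ℚ.* ε) (ℚ.*-zeroʳ ½) (ℚ.*-monoʳ-<-pos ½ 0<ε)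

  halves : ∀ ε → ½ ℚ.* ε ℚ.+ ½ ℚ.* ε ≡ ε
  halves ε = trans (sym (ℚ.*-distribʳ-+ ε ½ ½)) (ℚ.*-identityˡ ε)

  interchange : ∀ a b c e → (a ℚ.- b) ℚ.+ (c ℚ.- e) ≡ (a ℚ.+ c) ℚ.- (b ℚ.+ e)
  interchange a b c e = trans (ℚ₊.interchange a (ℚ.- b) c (ℚ.- e))
    (cong (a ℚ.+ c ℚ.+_) (sym (ℚ.neg-distrib-+ b e)))

  ∣-∣-sub : ∀ a b → ℚ.∣ a ∣ ℚ.- ℚ.∣ b ∣ ℚ.≤ ℚ.∣ a ℚ.- b ∣
  ∣-∣-sub a b = subst (ℚ.∣ a ∣ ℚ.- ℚ.∣ b ∣ ℚ.≤_) (ℚ₊.//-rightDividesʳ ℚ.∣ b ∣ ℚ.∣ a ℚ.- b ∣)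
    (ℚ.+-monoˡ-≤ (ℚ.- ℚ.∣ b ∣)
      (subst (λ c → ℚ.∣ c ∣ ℚ.≤ ℚ.∣ a ℚ.- b ∣ ℚ.+ ℚ.∣ b ∣) (ℚ₊.//-rightDividesˡ b a)
        (ℚ.∣p+q∣≤∣p∣+∣q∣ (a ℚ.- b) b)))

  ∣-∣-swap : ∀ a b → ℚ.∣ b ℚ.- a ∣ ≡ ℚ.∣ a ℚ.- b ∣
  ∣-∣-swap a b = trans (cong ℚ.∣_∣ (sym (ℚ₊.⁻¹-anti-homo‿- a b))) (ℚ.∣-p∣≡∣p∣ (a ℚ.- b))

  ∣∣-lipschitz : ∀ a b → ℚ.∣ ℚ.∣ a ∣ ℚ.- ℚ.∣ b ∣ ∣ ℚ.≤ ℚ.∣ a ℚ.- b ∣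
  ∣∣-lipschitz a b = [ (λ eq → subst (ℚ._≤ ℚ.∣ a ℚ.- b ∣) (sym eq) (∣-∣-sub a b))
                     , (λ eq → subst₂ ℚ._≤_
                         (sym (trans eq (ℚ₊.⁻¹-anti-homo‿- ℚ.∣ a ∣ ℚ.∣ b ∣)))
                         (∣-∣-swap a b) (∣-∣-sub b a))
                     ]′ (ℚ.∣p∣≡p∨∣p∣≡-p (ℚ.∣ a ∣ ℚ.- ℚ.∣ b ∣))

infixl 6 _+_ _-_
infix  8 -_

_+_ : ℝ → ℝ → ℝ
seq (x + y) n = seq x n ℚ.+ seq y n
cauchy (x + y) ε 0<ε with cauchy x (½ ℚ.* ε) (half-pos 0<ε) | cauchy y (½ ℚ.* ε) (half-pos 0<ε)
... | M , p | N , q = M ℕ.⊔ N , λ m n m≥ n≥ →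
  subst₂ ℚ._≤_ (cong ℚ.∣_∣ (interchange (seq x m) (seq x n) (seq y m) (seq y n))) (halves ε)
    (ℚ.≤-trans (ℚ.∣p+q∣≤∣p∣+∣q∣ (seq x m ℚ.- seq x n) (seq y m ℚ.- seq y n))
      (ℚ.+-mono-≤
        (p m n (ℕ.≤-trans (ℕ.m≤m⊔n M N) m≥) (ℕ.≤-trans (ℕ.m≤m⊔n M N) n≥))
        (q m n (ℕ.≤-trans (ℕ.m≤n⊔m M N) m≥) (ℕ.≤-trans (ℕ.m≤n⊔m M N) n≥))))

-_ : ℝ → ℝ
seq (- x) n = ℚ.- seq x n
cauchy (- x) ε 0<ε with cauchy x ε 0<ε
... | N , p = N , λ m n m≥ n≥ →
  subst (ℚ._≤ ε)
    (trans (sym (ℚ.∣-p∣≡∣p∣ (seq x m ℚ.- seq x n)))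
      (cong ℚ.∣_∣ (ℚ.neg-distrib-+ (seq x m) (ℚ.- seq x n))))
    (p m n m≥ n≥)

_-_ : ℝ → ℝ → ℝ
x - y = x + (- y)

∣_∣ : ℝ → ℝ
seq ∣ x ∣ n = ℚ.∣ seq x n ∣
cauchy ∣ x ∣ ε 0<ε with cauchy x ε 0<ε
... | N , p = N , λ m n m≥ n≥ →
  ℚ.≤-trans (∣∣-lipschitz (seq x m) (seq x n)) (p m n m≥ n≥)

+-nonneg : ∀ {x y} → 0ℝ ≤ x → 0ℝ ≤ y → 0ℝ ≤ x + y
+-nonneg {x} {y} 0≤x 0≤y ε 0<ε
  with 0≤x (½ ℚ.* ε) (half-pos 0<ε) | 0≤y (½ ℚ.* ε) (half-pos 0<ε)
... | M , p | N , q = M ℕ.⊔ N , λ n n≥ →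
  subst (0ℚ ℚ.≤_) (regroup (seq x n) (seq y n))
    (ℚ.+-mono-≤ (p n (ℕ.≤-trans (ℕ.m≤m⊔n M N) n≥)) (q n (ℕ.≤-trans (ℕ.m≤n⊔m M N) n≥)))
  where
  regroup : ∀ a b → (a ℚ.+ ½ ℚ.* ε) ℚ.+ (b ℚ.+ ½ ℚ.* ε) ≡ (a ℚ.+ b) ℚ.+ ε
  regroup a b = trans (ℚ₊.interchange a (½ ℚ.* ε) b (½ ℚ.* ε)) (cong (a ℚ.+ b ℚ.+_) (halves ε))

data σ⟨_⟩ {A : Set} {ℓ} (G : Pred (Pred A 0ℓ) ℓ) : Pred (Pred A 0ℓ) (lsuc 0ℓ ⊔ˡ ℓ) where
  generator  : ∀ {P} → P ∈ G → P ∈ σ⟨ G ⟩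
  empty      : ∅ ∈ σ⟨ G ⟩
  complement : ∀ {P} → P ∈ σ⟨ G ⟩ → ∁ P ∈ σ⟨ G ⟩
  union      : (P : ℕ → Pred A 0ℓ) → (∀ n → P n ∈ σ⟨ G ⟩) → ⋃ ℕ P ∈ σ⟨ G ⟩
  -- Sets are predicates, so membership must be closed under having the
  -- same elements.
  respects   : ∀ {P Q} → P ≐ Q → P ∈ σ⟨ G ⟩ → Q ∈ σ⟨ G ⟩

data Rectangle {A B : Set} {ℓ₁ ℓ₂} (𝒜 : Pred (Pred A 0ℓ) ℓ₁) (ℬ : Pred (Pred B 0ℓ) ℓ₂) :
               Pred (Pred (A × B) 0ℓ) (lsuc 0ℓ ⊔ˡ ℓ₁ ⊔ˡ ℓ₂) where
  rectangle : ∀ {P Q} → P ∈ 𝒜 → Q ∈ ℬ → (P ⟨×⟩ Q) ∈ Rectangle 𝒜 ℬ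

infixr 2 _⊗_

_⊗_ : ∀ {A B : Set} {ℓ₁ ℓ₂} → Pred (Pred A 0ℓ) ℓ₁ → Pred (Pred B 0ℓ) ℓ₂ →
      Pred (Pred (A × B) 0ℓ) (lsuc 0ℓ ⊔ˡ ℓ₁ ⊔ˡ ℓ₂)
𝒜 ⊗ ℬ = σ⟨ Rectangle 𝒜 ℬ ⟩

Measurable : ∀ {A B : Set} {ℓ₁ ℓ₂} → Pred (Pred A 0ℓ) ℓ₁ → Pred (Pred B 0ℓ) ℓ₂ →
             (A → B) → Set (lsuc 0ℓ ⊔ˡ ℓ₁ ⊔ˡ ℓ₂)
Measurable 𝒜 ℬ f = ∀ {P} → P ∈ ℬ → (f ⊢ P) ∈ 𝒜

Open : ∀ {A : Set} → (A → A → ℝ) → Pred (Pred A 0ℓ) 0ℓ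
Open δ U = ∀ x → x ∈ U → ∃[ ε ] (0ℝ < ε × (∀ y → δ x y < ε → y ∈ U))

Borel : ∀ {A : Set} → (A → A → ℝ) → Pred (Pred A 0ℓ) (lsuc 0ℓ)
Borel δ = σ⟨ Open δ ⟩

Borelℝ : Pred (Pred ℝ 0ℓ) (lsuc 0ℓ)
Borelℝ = Borel λ x y → ∣ x - y ∣

record OnlineProblem : Set₂ where
  field
    State           : Set
    Request         : Set
    MeasurableState : Pred (Pred State 0ℓ) (lsuc 0ℓ)
    -- cost u r v is incurred by moving from u to v to serve r.
    cost            : State → Request → State → ℝ
    cost-nonneg     : ∀ u r v → 0ℝ ≤ cost u r v

open OnlineProblem public

-- Finite request sequences are listed with the most recent request first.
History : OnlineProblem → Set
History P = List (Request P)

-- The state occupied after serving a history; the value at [] is the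
-- starting state.
DeterministicAlgorithm : OnlineProblem → Set
DeterministicAlgorithm P = History P → State P

requestCost : (P : OnlineProblem) → DeterministicAlgorithm P → History P → Request P → ℝ
requestCost P A h r = cost P (A h) r (A (r ∷ h))

totalCost : (P : OnlineProblem) → DeterministicAlgorithm P → History P → ℝ
totalCost P A []      = 0ℝ
totalCost P A (r ∷ h) = totalCost P A h + requestCost P A h r

data Mode : Set where
  trackX trackY : Mode

other : Mode → Mode
other trackX = trackY
other trackY = trackX

tracked : ∀ {A : Set} → A → A → Mode → A
tracked x y trackX = x
tracked x y trackY = y

-- A finite execution up to some moment, indexed by the requests already
-- served and the request, if any, that is revealed but not yet served.
-- A switch is pre-service when a request is pending, post-service (or
-- before the first request) when none is.
data Schedule (P : OnlineProblem) : History P → Maybe (Request P) → Set where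
  start  : Mode → Schedule P [] nothing
  reveal : ∀ {h} → Schedule P h nothing → (r : Request P) → Schedule P h (just r)
  switch : ∀ {h q} → Schedule P h q → Schedule P h q
  serve  : ∀ {h r} → Schedule P h (just r) → Schedule P (r ∷ h) nothing

mode : ∀ {P h q} → Schedule P h q → Mode
mode (start m)    = m
mode (reveal s _) = mode s
mode (switch s)   = other (mode s)
mode (serve s)    = mode s

-- The kernels are deterministic maps acting on the pair of online state
-- and potential. They may use the requests revealed so far (and hence the
-- simulated references) and the mode, but neither future requests nor
-- future switches. The mode given to switchKernel is the one being left.
record Implementation (P : OnlineProblem) : Set where
  field
    startState   : State P
    serveKernel  : History P → Request P → Mode → State P × ℝ → State P × ℝ
    switchKernel : History P → Maybe (Request P) → Mode → State P × ℝ → State P × ℝ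

  run : ∀ {h q} → Schedule P h q → State P × ℝ
  run (start _)            = startState , 0ℝ
  run (reveal s _)         = run s
  run (switch {h} {q} s)   = switchKernel h q (mode s) (run s)
  run (serve {h} {r} s)    = serveKernel h r (mode s) (run s)

  state : ∀ {h q} → Schedule P h q → State P
  state s = proj₁ (run s)

  Ψ : ∀ {h q} → Schedule P h q → ℝ
  Ψ s = proj₂ (run s)

record SwitchingAssumptions (P : OnlineProblem) (X Y : DeterministicAlgorithm P) : Set₁ where
  field
    implementation : Implementation P

  open Implementation implementation public

  field
    start-X  : startState ≡ X []
    start-Y  : startState ≡ Y []
    Ψ-nonneg : ∀ {h q} (s : Schedule P h q) → 0ℝ ≤ Ψ s

    tracking : ∀ {h r} (s : Schedule P h (just r)) →
      cost P (state s) r (state (serve s)) + (Ψ (serve s) - Ψ s)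
        ≤ requestCost P (tracked X Y (mode s)) h r

    D            : History P → ℝ
    D-bound      : ∀ h → D h ≤ totalCost P X h + totalCost P Y h
    switch-state : ∀ {h q} (s : Schedule P h q) → state (switch s) ≡ state s
    switch-Ψ     : ∀ {h q} (s : Schedule P h q) → Ψ (switch s) - Ψ s ≤ D h

    serveKernel-measurable  : ∀ h r m →
      Measurable (MeasurableState P ⊗ Borelℝ) (MeasurableState P ⊗ Borelℝ) (serveKernel h r m)
    switchKernel-measurable : ∀ h q m →
      Measurable (MeasurableState P ⊗ Borelℝ) (MeasurableState P ⊗ Borelℝ) (switchKernel h q m)

record MetricalTaskSystem : Set₁ where
  field
    Point    : Set
    d        : Point → Point → ℝ
    isMetric : IsGeneralMetric _≡_ _≃_ _≤_ 0ℝ _+_ d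
    initial  : Point

  open IsGeneralMetric isMetric public using (nonNegative)

  Task : Set
  Task = Σ[ ℓ ∈ (Point → ℝ) ] (∀ u → 0ℝ ≤ ℓ u)

  problem : OnlineProblem
  problem = record
    { State           = Point
    ; Request         = Task
    ; MeasurableState = Borel d
    ; cost            = λ u (ℓ , _) v → d u v + ℓ v
    ; cost-nonneg     = λ u (ℓ , ℓ≥0) v → +-nonneg {d u v} {ℓ v} nonNegative (ℓ≥0 v)
    }

open MetricalTaskSystem public using (Point; initial; problem)

-- Let the potential dominate the distance from the online state to the
-- tracked reference. Serving moves onto the tracked reference and resets
-- the potential to 0, which the triangle inequality pays for; switching
-- after h leaves the state alone and adds D h = d (X h) (Y h) to the
-- potential. Both references start at the same point and pay for their
-- movement, so D h is at most the sum of their costs.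
module Submission where

open import Defs
open import Data.List.Base using ([]; _∷_)
open import Data.Maybe.Base using (just)
open import Data.Product.Base using (_,_; proj₁; map; map₂)
open import Data.Rational.Base as ℚ using (0ℚ; 1ℚ)
import Data.Rational.Properties as ℚ
open import Data.Rational.Solver using (module +-*-Solver)
open import Data.Unit.Base using (tt)
open import Function.Base using (id; const)
open import Function.Metric.Structures using (IsGeneralMetric)
open import Level using (0ℓ)
open import Relation.Binary.PropositionalEquality using (_≡_; refl; sym; cong; subst; subst₂)
open import Relation.Binary.Structures using (IsPartialOrder)
open import Relation.Unary using (Pred; _∈_; _⊢_)

open +-*-Solver using (solve; _:+_; _:-_; :-_; _:=_; con)

-- Arithmetic on `ℝ` is termwise, so ring identities hold exactly at every index and the rational
-- solver proves them with no limit argument.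
≗⇒≤ : ∀ {x y} → (∀ n → seq x n ≡ seq y n) → x ≤ y
≗⇒≤ {x} {y} x≗y ε 0<ε = 0 , λ n _ →
  subst₂ ℚ._≤_ (ℚ.+-identityʳ (seq x n)) (cong (ℚ._+ ε) (x≗y n))
    (ℚ.+-monoʳ-≤ (seq x n) (ℚ.<⇒≤ 0<ε))

x≤y⇒0≤y-x : ∀ {x y} → x ≤ y → 0ℝ ≤ y - x
x≤y⇒0≤y-x {x} {y} x≤y ε 0<ε = map₂ (λ p n N≤n →
  subst₂ ℚ._≤_ (ℚ.+-inverseʳ (seq x n)) (regroup (seq x n) (seq y n) ε)
    (ℚ.+-monoˡ-≤ (ℚ.- seq x n) (p n N≤n))) (x≤y ε 0<ε)
  where
  regroup : ∀ a b e → (b ℚ.+ e) ℚ.+ ℚ.- a ≡ (b ℚ.- a) ℚ.+ e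
  regroup = solve 3 (λ a b e → (b :+ e) :+ :- a := (b :- a) :+ e) refl

0≤y-x⇒x≤y : ∀ {x y} → 0ℝ ≤ y - x → x ≤ y
0≤y-x⇒x≤y {x} {y} 0≤y-x ε 0<ε = map₂ (λ p n N≤n →
  subst₂ ℚ._≤_ (ℚ.+-identityˡ (seq x n)) (regroup (seq x n) (seq y n) ε)
    (ℚ.+-monoˡ-≤ (seq x n) (p n N≤n))) (0≤y-x ε 0<ε)
  where
  regroup : ∀ a b e → ((b ℚ.- a) ℚ.+ e) ℚ.+ a ≡ b ℚ.+ e
  regroup = solve 3 (λ a b e → ((b :- a) :+ e) :+ a := b :+ e) refl

≤-respʳ-≗ : ∀ {x y z} → (∀ n → seq y n ≡ seq z n) → x ≤ y → x ≤ z
≤-respʳ-≗ {x} y≗z x≤y ε 0<ε = map₂ (λ p n N≤n →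
  subst (λ q → seq x n ℚ.≤ q ℚ.+ ε) (y≗z n) (p n N≤n)) (x≤y ε 0<ε)

-- Passing to nonnegative differences reuses the halving of ε already done in `+-nonneg`.
+-mono-≤ : ∀ {x y z w} → x ≤ y → z ≤ w → x + z ≤ y + w
+-mono-≤ {x} {y} {z} {w} x≤y z≤w = 0≤y-x⇒x≤y {x + z} {y + w}
  (≤-respʳ-≗ {0ℝ} {(y - x) + (w - z)} {(y + w) - (x + z)}
    (λ n → regroup (seq x n) (seq y n) (seq z n) (seq w n))
    (+-nonneg {y - x} {w - z} (x≤y⇒0≤y-x {x} {y} x≤y) (x≤y⇒0≤y-x {z} {w} z≤w)))
  where
  regroup : ∀ a b c e → (b ℚ.- a) ℚ.+ (e ℚ.- c) ≡ (b ℚ.+ e) ℚ.- (a ℚ.+ c)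
  regroup = solve 4 (λ a b c e → (b :- a) :+ (e :- c) := (b :+ e) :- (a :+ c)) refl

<-respˡ-≗ : ∀ {x y z} → (∀ n → seq x n ≡ seq y n) → x < z → y < z
<-respˡ-≗ {z = z} x≗y (ε , 0<ε , N , p) = ε , 0<ε , N , λ n N≤n →
  subst (λ q → q ℚ.+ ε ℚ.≤ seq z n) (x≗y n) (p n N≤n)

1ℝ : ℝ
1ℝ = mkℝ (λ _ → 1ℚ) λ ε 0<ε → 0 , λ _ _ _ _ → ℚ.<⇒≤ 0<ε

0<1 : 0ℝ < 1ℝ
0<1 = 1ℚ , ℚ.positive⁻¹ 1ℚ , 0 , λ _ _ → ℚ.≤-refl

-- Whether a point lies in a set need not be decidable, so the preimage of
-- a set under a constant map cannot be split into ∅ and U; but any set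
-- whose membership does not depend on the point is open.
Open-const : ∀ {A : Set} (δ : A → A → ℝ) (C : Set) → const C ∈ Open δ
Open-const δ C x c = 1ℝ , 0<1 , λ _ _ → c

-- Preimages commute with complements and countable unions, so induction on the generation of the
-- σ-algebra leaves only the generators to check.
measurable-σ : ∀ {A B : Set} {ℓ₁ ℓ₂} {G : Pred (Pred A 0ℓ) ℓ₁} {H : Pred (Pred B 0ℓ) ℓ₂} {f : A → B} →
  (∀ {P} → P ∈ H → (f ⊢ P) ∈ σ⟨ G ⟩) → Measurable σ⟨ G ⟩ σ⟨ H ⟩ f
measurable-σ gen (generator P∈H)           = gen P∈H
measurable-σ gen empty                     = empty
measurable-σ gen (complement P∈σ)          = complement (measurable-σ gen P∈σ)
measurable-σ gen (union P P∈σ)             = union _ λ n → measurable-σ gen (P∈σ n)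
measurable-σ gen (respects (P⊆Q , Q⊆P) P∈σ) =
  respects ((λ p → P⊆Q p) , (λ q → Q⊆P q)) (measurable-σ gen P∈σ)

measurable-map : ∀ {A B C D : Set} {ℓ₁ ℓ₂ ℓ₃ ℓ₄}
  {𝒜 : Pred (Pred A 0ℓ) ℓ₁} {ℬ : Pred (Pred B 0ℓ) ℓ₂}
  {𝒞 : Pred (Pred C 0ℓ) ℓ₃} {𝒟 : Pred (Pred D 0ℓ) ℓ₄} {f : A → C} {g : B → D} →
  Measurable 𝒜 𝒞 f → Measurable ℬ 𝒟 g → Measurable (𝒜 ⊗ ℬ) (𝒞 ⊗ 𝒟) (map f g)
measurable-map f-meas g-meas = measurable-σ λ where
  (rectangle P∈𝒞 Q∈𝒟) → generator (rectangle (f-meas P∈𝒞) (g-meas Q∈𝒟))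

measurable-const : ∀ {A B C : Set} {ℓ} (δ : A → A → ℝ) (ρ : B → B → ℝ)
  {𝒞 : Pred (Pred C 0ℓ) ℓ} (c : C) → Measurable (Borel δ ⊗ Borel ρ) 𝒞 (const c)
-- The preimage is the rectangle with sides `const (P c)` and the whole second space, both open;
-- `respects` drops the trivial second condition.
measurable-const δ ρ c {P} _ = respects (proj₁ , (_, tt))
  (generator (rectangle (generator (Open-const δ (P c))) (generator (λ _ _ → 1ℝ , 0<1 , λ _ _ → tt))))

dist : ℝ → ℝ → ℝ
dist x y = ∣ x - y ∣

-- Translation is an isometry, so the radius that works at `x + c` works at `x`.
Open-+ʳ : ∀ c {P : Pred ℝ 0ℓ} → P ∈ Open dist → ((_+ c) ⊢ P) ∈ Open dist
Open-+ʳ c P-open x x+c∈P with P-open (x + c) x+c∈P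
... | ε , 0<ε , ball⊆P = ε , 0<ε , λ y x-y<ε → ball⊆P (y + c)
  (<-respˡ-≗ {dist x y} {dist (x + c) (y + c)} {ε}
    (λ n → cong ℚ.∣_∣ (translate (seq x n) (seq y n) (seq c n))) x-y<ε)
  where
  translate : ∀ a b c → a ℚ.- b ≡ (a ℚ.+ c) ℚ.- (b ℚ.+ c)
  translate = solve 3 (λ a b c → a :- b := (a :+ c) :- (b :+ c)) refl

measurable-+ʳ : ∀ c → Measurable Borelℝ Borelℝ (_+ c)
measurable-+ʳ c = measurable-σ λ {P} P-open → generator (Open-+ʳ c {P} P-open)

module _ (M : MetricalTaskSystem) where
  open MetricalTaskSystem M using (d; isMetric)
  open IsGeneralMetric isMetric using (nonNegative; ≈⇒0; triangle) renaming (sym to d-sym)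
  open IsPartialOrder (IsGeneralMetric.isPartialOrder isMetric)
    using () renaming (refl to ≤-refl; reflexive to ≤-reflexive; trans to ≤-trans)

  d-self≤0 : ∀ {u v} → u ≡ v → d u v ≤ 0ℝ
  d-self≤0 {u} {v} u≡v = ≤-reflexive {d u v} {0ℝ} (≈⇒0 u≡v)

  -- The distance from the start is at most the length of the path travelled, and each step costs at
  -- least its movement because task costs are nonnegative.
  d≤totalCost : ∀ (A : DeterministicAlgorithm (problem M)) → A [] ≡ initial M →
    ∀ h → d (initial M) (A h) ≤ totalCost (problem M) A h
  d≤totalCost A A[]≡i []            = d-self≤0 (sym A[]≡i)
  d≤totalCost A A[]≡i (r@(ℓ , ℓ≥0) ∷ h) =
    ≤-trans {d i v} {d i u + d u v} {T + (d u v + ℓ v)} (triangle i u v)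
      (+-mono-≤ {d i u} {T} {d u v} {d u v + ℓ v} (d≤totalCost A A[]≡i h)
        (0≤y-x⇒x≤y {d u v} {d u v + ℓ v}
          (≤-respʳ-≗ {0ℝ} {ℓ v} {(d u v + ℓ v) - d u v}
            (λ n → cancel (seq (ℓ v) n) (seq (d u v) n)) (ℓ≥0 v))))
    where
    i = initial M
    u = A h
    v = A (r ∷ h)
    T = totalCost (problem M) A h
    cancel : ∀ a b → a ≡ (b ℚ.+ a) ℚ.- b
    cancel = solve 2 (λ a b → a := (b :+ a) :- b) refl

  module _ (X Y : DeterministicAlgorithm (problem M))
           (X[]≡i : X [] ≡ initial M) (Y[]≡i : Y [] ≡ initial M) where

    D : History (problem M) → ℝ
    D h = d (X h) (Y h)

    D≤totalCosts : ∀ h → D h ≤ totalCost (problem M) X h + totalCost (problem M) Y h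
    D≤totalCosts h =
      ≤-trans {D h} {d (X h) i + d i (Y h)} {TX + TY} (triangle (X h) i (Y h))
        (+-mono-≤ {d (X h) i} {TX} {d i (Y h)} {TY}
          (≤-trans {d (X h) i} {d i (X h)} {TX}
            (≤-reflexive {d (X h) i} {d i (X h)} (d-sym (X h) i)) (d≤totalCost X X[]≡i h))
          (d≤totalCost Y Y[]≡i h))
      where
      i  = initial M
      TX = totalCost (problem M) X h
      TY = totalCost (problem M) Y h

    -- A switch to Y could also set the potential to d u (Y h) exactly, but
    -- measurability of u ↦ (u , d u (Y h)) needs intersections of Borel
    -- sets, whose reduction to complements and unions is not constructive.
    -- Adding D h gives a product of maps.
    implementation : Implementation (problem M)
    implementation = record
      { startState   = initial M
      ; serveKernel  = λ h r m → const (tracked X Y m (r ∷ h) , 0ℝ)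
      ; switchKernel = λ h _ _ → map id (_+ D h)
      }

    open Implementation implementation

    d-tracked-other : ∀ m h → d (tracked X Y m h) (tracked X Y (other m) h) ≤ D h
    d-tracked-other trackX h = ≤-refl {D h}
    d-tracked-other trackY h = ≤-reflexive {d (Y h) (X h)} {D h} (d-sym (Y h) (X h))

    -- The invariant behind both `Ψ-nonneg` and `tracking`. A switch moves the target by at most
    -- `D h`, exactly what the potential gains; after serving, state and target coincide.
    d-tracked≤Ψ : ∀ {h q} (s : Schedule (problem M) h q) →
      d (state s) (tracked X Y (mode s) h) ≤ Ψ s
    d-tracked≤Ψ (start trackX) = d-self≤0 (sym X[]≡i)
    d-tracked≤Ψ (start trackY) = d-self≤0 (sym Y[]≡i)
    d-tracked≤Ψ (reveal s _)   = d-tracked≤Ψ s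
    d-tracked≤Ψ (switch {h} s) =
      ≤-trans {d u w} {d u v + d v w} {Ψ s + D h} (triangle u v w)
        (+-mono-≤ {d u v} {Ψ s} {d v w} {D h} (d-tracked≤Ψ s) (d-tracked-other (mode s) h))
      where
      u = state s
      v = tracked X Y (mode s) h
      w = tracked X Y (other (mode s)) h
    d-tracked≤Ψ (serve s)      = d-self≤0 refl

    Ψ-nonneg : ∀ {h q} (s : Schedule (problem M) h q) → 0ℝ ≤ Ψ s
    Ψ-nonneg {h} s = ≤-trans {0ℝ} {d (state s) v} {Ψ s} nonNegative (d-tracked≤Ψ s)
      where v = tracked X Y (mode s) h

    tracking : ∀ {h r} (s : Schedule (problem M) h (just r)) →
      cost (problem M) (state s) r (state (serve s)) + (Ψ (serve s) - Ψ s)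
        ≤ requestCost (problem M) (tracked X Y (mode s)) h r
    tracking {h} {r@(ℓ , _)} s =
      -- Going from `u` to `w` via the old reference position `v` costs at most `Ψ s + d v w`;
      -- resetting the potential contributes `Δ`, which cancels `Ψ s`.
      ≤-respʳ-≗ {(d u w + ℓ w) + Δ} {((Ψ s + d v w) + ℓ w) + Δ} {d v w + ℓ w}
        (λ n → cancel (seq (Ψ s) n) (seq (d v w) n) (seq (ℓ w) n))
        (+-mono-≤ {d u w + ℓ w} {(Ψ s + d v w) + ℓ w} {Δ} {Δ}
          (+-mono-≤ {d u w} {Ψ s + d v w} {ℓ w} {ℓ w}
            (≤-trans {d u w} {d u v + d v w} {Ψ s + d v w} (triangle u v w)
              (+-mono-≤ {d u v} {Ψ s} {d v w} {d v w} (d-tracked≤Ψ s) (≤-refl {d v w})))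
            (≤-refl {ℓ w}))
          (≤-refl {Δ}))
      where
      u = state s
      v = tracked X Y (mode s) h
      w = tracked X Y (mode s) (r ∷ h)
      Δ = 0ℝ - Ψ s
      cancel : ∀ p a b → ((p ℚ.+ a) ℚ.+ b) ℚ.+ (0ℚ ℚ.- p) ≡ a ℚ.+ b
      cancel = solve 3 (λ p a b → ((p :+ a) :+ b) :+ (con 0ℚ :- p) := a :+ b) refl

    switch-Ψ : ∀ {h q} (s : Schedule (problem M) h q) → Ψ (switch s) - Ψ s ≤ D h
    switch-Ψ {h} s = ≗⇒≤ {(Ψ s + D h) - Ψ s} {D h} λ n → cancel (seq (Ψ s) n) (seq (D h) n)
      where
      cancel : ∀ p a → (p ℚ.+ a) ℚ.- p ≡ a
      cancel = solve 2 (λ p a → (p :+ a) :- p := a) refl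

lemma43 : (M : MetricalTaskSystem) (X Y : DeterministicAlgorithm (problem M)) →
    X [] ≡ initial M → Y [] ≡ initial M →
    SwitchingAssumptions (problem M) X Y
lemma43 M X Y X[]≡i Y[]≡i = record
  { implementation          = implementation M X Y X[]≡i Y[]≡i
  ; start-X                 = sym X[]≡i
  ; start-Y                 = sym Y[]≡i
  ; Ψ-nonneg                = Ψ-nonneg M X Y X[]≡i Y[]≡i
  ; tracking                = tracking M X Y X[]≡i Y[]≡i
  ; D                       = D M X Y X[]≡i Y[]≡i
  ; D-bound                 = D≤totalCosts M X Y X[]≡i Y[]≡i
  ; switch-state            = λ _ → refl
  ; switch-Ψ                = switch-Ψ M X Y X[]≡i Y[]≡i
  ; serveKernel-measurable  = λ h r m →
      measurable-const d dist {Borel d ⊗ Borelℝ} (tracked X Y m (r ∷ h) , 0ℝ)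
  ; switchKernel-measurable = λ h q m → measurable-map id (measurable-+ʳ (D M X Y X[]≡i Y[]≡i h))
  }
  where open MetricalTaskSystem M using (d)
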